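{- Let $M$ be a finite loopless matroid with ground set $E$ and rank function $r$, such that $|E|$ and $r(M)=r(E)$ are coprime, i.e. $\gcd(|E|,r(M))=1$. Then there is a cyclic ordering of $E$ such that every $r(M)$ cyclically consecutive elements form a base of $M$ if and only if for every non-empty $A\subseteq E$ we have \[\frac{|A|}{r(A)}\le\frac{|E|}{r(M)}.\]
   Context: A cyclic ordering $(e_1,\dots,e_m)$ of $E$ (with $m=|E|$) is an ordering of all elements of $E$ considered cyclically; a set of $k$ cyclically consecutive elements is a set $\{e_i,e_{i+1},\dots,e_{i+k-1}\}$ with indices taken modulo $m$. -}

module Defs where

open import Data.Nat using (ℕ; zero; suc; _+_; _*_; _≤_)
open import Data.Nat.DivMod using (_mod_)
open import Data.Nat.Coprimality using (Coprime)
open import Data.Fin using (Fin; toℕ)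
open import Data.Fin.Subset using (Subset; _⊆_; _∪_; _∩_; ⊤; ⊥; ⁅_⁆; ∣_∣; Nonempty)
open import Data.Fin.Permutation using (Permutation′; _⟨$⟩ʳ_)
open import Data.Product using (_×_; Σ-syntax)
open import Relation.Binary.PropositionalEquality using (_≡_)

record Matroid (n : ℕ) : Set where
  field
    r        : Subset n → ℕ
    r-bound  : ∀ X → r X ≤ ∣ X ∣
    r-mono   : ∀ {X Y} → X ⊆ Y → r X ≤ r Y
    r-submod : ∀ X Y → r (X ∪ Y) + r (X ∩ Y) ≤ r X + r Y

open Matroid public

rankM : ∀ {n} → Matroid n → ℕ
rankM M = r M ⊤

Loopless : ∀ {n} → Matroid n → Set
Loopless M = ∀ e → r M ⁅ e ⁆ ≡ 1

IsBase : ∀ {n} → Matroid n → Subset n → Set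
IsBase M B = r M B ≡ ∣ B ∣ × ∣ B ∣ ≡ rankM M

window : ∀ {n} → Permutation′ n → Fin n → ℕ → Subset n
window {zero}  σ i k       = ⊥
window {suc n} σ i zero    = ⊥
window {suc n} σ i (suc k) = window σ i k ∪ ⁅ σ ⟨$⟩ʳ ((toℕ i + k) mod suc n) ⁆

HasCyclicBaseOrdering : ∀ {n} → Matroid n → Set
HasCyclicBaseOrdering {n} M =
  Σ[ σ ∈ Permutation′ n ] (∀ i → IsBase M (window σ i (rankM M)))

-- |A| / r(A) ≤ |E| / r(M) for all nonempty A, cross-multiplied
-- (denominators are positive for loopless M and nonempty A).
UniformDensity : ∀ {n} → Matroid n → Set
UniformDensity {n} M = ∀ (A : Subset n) → Nonempty A → ∣ A ∣ * rankM M ≤ n * r M A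

{-# OPTIONS --safe #-}
module Submission where

-- The easy direction is double counting of A against the n windows. For the converse give each
-- element an arc of k = r(M) cyclically consecutive times out of n = |E|, and let I i be the set
-- of elements active at time i. If every I i has rank k, then every I i has exactly k elements,
-- so the number of arcs starting at time i has periods n and k; by coprimality it is constant,
-- hence one, and the starting times give the ordering.
-- To find such arcs, take an assignment maximising the sum of the ranks of the I i. When e is
-- spanned by the other elements active at its last time, its arc may be moved one step back:
-- the rank at the time it leaves does not drop, so by maximality no closure of any I i changes.
-- After finitely many moves a set D of elements can never be moved again, while every element
-- outside D can be moved to any time, so is spanned by every I i. Moreover the elements of
-- I i ∩ D are coloops of I i ∪ ∁ D. Hence r(I i) ≥ r(∁ D) + |I i ∩ D|, and summing over i
-- with the density bound for ∁ D gives Σ r(I i) ≥ n k.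

open import Defs
open import Data.Nat using (ℕ)
open import Data.Nat.Coprimality using (Coprime)
open import Function.Bundles using (_⇔_)

import Data.Nat.Properties
open import Algebra.Properties.Semiring.Sum Data.Nat.Properties.+-*-semiring
  using (sum; sum-cong-≗; sum-init-last; ∑-comm; ∑-distrib-+; *-distribˡ-sum)
open import Data.Bool using (Bool; true; false; _∧_)
open import Data.Bool.Properties using (∧-identityʳ; ∧-zeroʳ)
open import Data.Empty using (⊥; ⊥-elim)
open import Data.Fin using (Fin; zero; suc; toℕ; inject₁; fromℕ; finToFun; funToFin)
open import Data.Fin.Permutation
  using (Permutation′; permutation; _⟨$⟩ʳ_; _⟨$⟩ˡ_; inverseʳ; inverseˡ)
import Data.Fin.Properties as Fin
open import Data.Fin.Subset renaming (⊥ to ∅)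
open import Data.Fin.Subset.Induction using (⊂-wellFounded; ⊃-wellFounded; Acc; acc)
open import Data.Fin.Subset.Properties
open import Data.Nat hiding (∣_-_∣)
open import Data.Nat.Coprimality using (coprime-Bézout)
open import Data.Nat.DivMod
open import Data.Nat.GCD using (module Bézout)
open import Data.Nat.Properties
open import Data.Product using (Σ-syntax; ∃; _×_; _,_; proj₁; proj₂)
open import Data.Sum using (_⊎_; inj₁; inj₂; [_,_]′)
open import Data.Vec using ([]; _∷_; there; lookup; tabulate)
open import Data.Vec.Functional using (updateAt)
open import Data.Vec.Functional.Properties using (updateAt-updates; updateAt-minimal)
open import Data.Vec.Properties
  using (lookup∘tabulate; lookup⇒[]=; []=⇒lookup; lookup-zipWith; tabulate-cong)
open import Function using (_∘_; id; mk⇔)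
open import Relation.Binary.Definitions using (tri<; tri≈; tri>)
open import Relation.Binary.PropositionalEquality
open import Relation.Nullary using (¬_; Dec; yes; no; does; contradiction)
open import Relation.Nullary.Decidable
  using (decidable-stable; dec-true; dec-false; does-⇔; _×-dec_)
open import Relation.Unary using (Decidable)

-- Inclusions and cardinalities of finite subsets.

x∈p─q⇒x∉q : ∀ {n} {x : Fin n} p q → x ∈ p ─ q → x ∉ q
x∈p─q⇒x∉q (_ ∷ p) (_ ∷ q) (there x∈) (there x∈q) = x∈p─q⇒x∉q p q x∈ x∈q

module _ {n : ℕ} where

  private variable
    X Y Z : Subset n
    x y   : Fin n

  ∪-least : X ⊆ Z → Y ⊆ Z → X ∪ Y ⊆ Z
  ∪-least {X} {Y = Y} X⊆Z Y⊆Z = [ X⊆Z , Y⊆Z ]′ ∘ x∈p∪q⁻ X Y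

  ∪ˡ : x ∈ X → x ∈ X ∪ Y
  ∪ˡ = x∈p∪q⁺ ∘ inj₁

  ∪ʳ : x ∈ Y → x ∈ X ∪ Y
  ∪ʳ = x∈p∪q⁺ ∘ inj₂

  ⁅⁆⊆ : x ∈ X → ⁅ x ⁆ ⊆ X
  ⁅⁆⊆ {x} {X} x∈X y∈ = subst (_∈ X) (sym (x∈⁅y⁆⇒x≡y x y∈)) x∈X

  ∪-mono : ∀ {W} → X ⊆ Z → Y ⊆ W → X ∪ Y ⊆ Z ∪ W
  ∪-mono X⊆Z Y⊆W = ∪-least (∪ˡ ∘ X⊆Z) (∪ʳ ∘ Y⊆W)

  -⊆ : X - y ⊆ X
  -⊆ {X} {y} = p─q⊆p X ⁅ y ⁆

  ∈-⇒≢ : x ∈ X - y → x ≢ y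
  ∈-⇒≢ {x} {X} {y} x∈ refl = x∈p─q⇒x∉q X ⁅ y ⁆ x∈ (x∈⁅x⁆ y)

  -mono : X ⊆ Y → X - y ⊆ Y - y
  -mono X⊆Y x∈ = x∈p∧x≢y⇒x∈p-y (X⊆Y (-⊆ x∈)) (∈-⇒≢ x∈)

  ⊆-∪⁅⁆ : X ⊆ (X - y) ∪ ⁅ y ⁆
  ⊆-∪⁅⁆ {X} {y} {x} x∈X with x Fin.≟ y
  ... | yes refl = ∪ʳ (x∈⁅x⁆ x)
  ... | no  x≢y  = ∪ˡ (x∈p∧x≢y⇒x∈p-y x∈X x≢y)

  ∪-⊆-∪⁅⁆ : X ∪ Y ⊆ (X ∪ (Y - y)) ∪ ⁅ y ⁆
  ∪-⊆-∪⁅⁆ = ∪-least (∪ˡ ∘ ∪ˡ) (∪-mono ∪ʳ id ∘ ⊆-∪⁅⁆)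

  subset-induction : (Q : Subset n → Set) → (∀ {P} → Empty P → Q P) →
    (∀ {P g} → g ∈ P → Q (P - g) → Q P) → ∀ P → Q P
  subset-induction Q base step P = go (⊂-wellFounded P)
    where
    go : ∀ {P} → Acc _⊂_ P → Q P
    go {P} (acc rec) with nonempty? P
    ... | no  empty     = base empty
    ... | yes (g , g∈P) = step g∈P (go (rec (x∈p⇒p-x⊂p g∈P)))

∣p∪q∣≤∣p∣+∣q∣ : ∀ {n} (p q : Subset n) → ∣ p ∪ q ∣ ≤ ∣ p ∣ + ∣ q ∣
∣p∪q∣≤∣p∣+∣q∣ []          []          = z≤n
∣p∪q∣≤∣p∣+∣q∣ (false ∷ p) (false ∷ q) = ∣p∪q∣≤∣p∣+∣q∣ p q
∣p∪q∣≤∣p∣+∣q∣ (false ∷ p) (true ∷ q)  =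
  ≤-trans (s≤s (∣p∪q∣≤∣p∣+∣q∣ p q)) (≤-reflexive (sym (+-suc _ _)))
∣p∪q∣≤∣p∣+∣q∣ (true ∷ p)  (false ∷ q) = s≤s (∣p∪q∣≤∣p∣+∣q∣ p q)
∣p∪q∣≤∣p∣+∣q∣ (true ∷ p)  (true ∷ q)  =
  s≤s (≤-trans (∣p∪q∣≤∣p∣+∣q∣ p q) (+-monoʳ-≤ ∣ p ∣ (n≤1+n _)))

-- Closure, exchange and coloops in a matroid.

module Closure {n : ℕ} (M : Matroid n) where

  private variable
    U X Y Z : Subset n
    e f g   : Fin n

  infix 4 _⊢_
  -- Membership of `e` in the matroid closure of `X`. An inequality suffices, since `r-mono` gives
  -- the reverse one.
  _⊢_ : Subset n → Fin n → Set
  X ⊢ e = r M (X ∪ ⁅ e ⁆) ≤ r M X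

  ⊢? : ∀ X e → Dec (X ⊢ e)
  ⊢? X e = r M (X ∪ ⁅ e ⁆) ≤? r M X

  ∈⇒⊢ : e ∈ X → X ⊢ e
  ∈⇒⊢ e∈X = r-mono M (∪-least id (⁅⁆⊆ e∈X))

  -- Submodularity for `Y` and `X ∪ ⁅ e ⁆`: their union contains `Y ∪ ⁅ e ⁆` and their intersection
  -- contains `X`.
  ⊢-mono : X ⊆ Y → X ⊢ e → Y ⊢ e
  ⊢-mono {X} {Y} {e} X⊆Y X⊢e = +-cancelʳ-≤ (r M X) _ _ (begin
    r M (Y ∪ ⁅ e ⁆) + r M X                          ≤⟨ +-mono-≤ (r-mono M (∪-mono id ∪ʳ))
                                                          (r-mono M λ x∈ → x∈p∩q⁺ (X⊆Y x∈ , ∪ˡ x∈)) ⟩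
    r M (Y ∪ (X ∪ ⁅ e ⁆)) + r M (Y ∩ (X ∪ ⁅ e ⁆))    ≤⟨ r-submod M Y (X ∪ ⁅ e ⁆) ⟩
    r M Y + r M (X ∪ ⁅ e ⁆)                          ≤⟨ +-monoʳ-≤ (r M Y) X⊢e ⟩
    r M Y + r M X                                    ∎)
    where open ≤-Reasoning

  ⊢-cut : X ⊢ e → X ∪ ⁅ e ⁆ ⊢ g → X ⊢ g
  ⊢-cut X⊢e Xe⊢g = ≤-trans (r-mono M (∪-mono ∪ˡ id)) (≤-trans Xe⊢g X⊢e)

  r-∪-≤ : ∀ X Y → r M (X ∪ Y) ≤ r M X + ∣ Y ∣
  r-∪-≤ X Y = begin
    r M (X ∪ Y)                ≤⟨ m≤m+n _ _ ⟩
    r M (X ∪ Y) + r M (X ∩ Y)  ≤⟨ r-submod M X Y ⟩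
    r M X + r M Y              ≤⟨ +-monoʳ-≤ (r M X) (r-bound M Y) ⟩
    r M X + ∣ Y ∣              ∎
    where open ≤-Reasoning

  -- Mac Lane-Steinitz exchange: adding `f` to `X` raises the rank by at most one, and `e` alone
  -- already raises it by at least one.
  exchange : ¬ X ⊢ e → X ∪ ⁅ f ⁆ ⊢ e → X ∪ ⁅ e ⁆ ⊢ f
  exchange {X} {e} {f} X⊬e Xf⊢e = begin
    r M ((X ∪ ⁅ e ⁆) ∪ ⁅ f ⁆)  ≤⟨ r-mono M (∪-least (∪-mono ∪ˡ id) (∪ˡ ∘ ∪ʳ)) ⟩
    r M ((X ∪ ⁅ f ⁆) ∪ ⁅ e ⁆)  ≤⟨ Xf⊢e ⟩
    r M (X ∪ ⁅ f ⁆)            ≤⟨ r-∪-≤ X ⁅ f ⁆ ⟩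
    r M X + ∣ ⁅ f ⁆ ∣          ≡⟨ cong (r M X +_) (∣⁅x⁆∣≡1 f) ⟩
    r M X + 1                  ≡⟨ +-comm (r M X) 1 ⟩
    suc (r M X)                ≤⟨ ≰⇒> X⊬e ⟩
    r M (X ∪ ⁅ e ⁆)            ∎
    where open ≤-Reasoning

  r-∪-spanned : ∀ Y → (∀ {e} → e ∈ Y → X ⊢ e) → r M (X ∪ Y) ≤ r M X
  r-∪-spanned {X} = subset-induction (λ Y → (∀ {e} → e ∈ Y → X ⊢ e) → r M (X ∪ Y) ≤ r M X)
    (λ empty _ → r-mono M (∪-least id λ x∈ → contradiction (_ , x∈) empty))
    λ {Y} {g} g∈Y ih X⊢ → begin
      r M (X ∪ Y)                    ≤⟨ r-mono M ∪-⊆-∪⁅⁆ ⟩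
      r M ((X ∪ (Y - g)) ∪ ⁅ g ⁆)    ≤⟨ ⊢-mono ∪ˡ (X⊢ g∈Y) ⟩
      r M (X ∪ (Y - g))              ≤⟨ ih (X⊢ ∘ -⊆) ⟩
      r M X                          ∎
    where open ≤-Reasoning

  -- For `g ∈ U` this says that `g` is a coloop of the restriction of `M` to `U`.
  Coloop : Subset n → Fin n → Set
  Coloop U g = ¬ (U - g ⊢ g)

  -- A coloop lies in no circuit, so the elements of `P` can be discarded one by one. If discarding
  -- `g` destroyed the spanning of `f`, exchange would put `g` in the closure of a subset of
  -- `U - g`.
  coloop-strip : ∀ P → (∀ {g} → g ∈ P → Coloop U g) → Z ⊆ U → P ⊆ U → f ∈ U → f ∉ P →
    Z ∪ P ⊢ f → Z ⊢ f
  coloop-strip {U} {Z} {f} = subset-induction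
    (λ P → (∀ {g} → g ∈ P → Coloop U g) → Z ⊆ U → P ⊆ U → f ∈ U → f ∉ P → Z ∪ P ⊢ f → Z ⊢ f)
    (λ empty _ _ _ _ _ → ⊢-mono (∪-least id λ x∈ → contradiction (_ , x∈) empty))
    λ {P} {g} g∈P ih col Z⊆U P⊆U f∈U f∉P ZP⊢f →
      ih (col ∘ -⊆) Z⊆U (P⊆U ∘ -⊆) f∈U (f∉P ∘ -⊆) (drop g∈P col Z⊆U P⊆U f∈U f∉P ZP⊢f)
    where
    drop : ∀ {P g} → g ∈ P → (∀ {g} → g ∈ P → Coloop U g) → Z ⊆ U → P ⊆ U → f ∈ U → f ∉ P →
      Z ∪ P ⊢ f → Z ∪ (P - g) ⊢ f
    drop {P} {g} g∈P col Z⊆U P⊆U f∈U f∉P ZP⊢f with g ∈? Z ∪ (P - g) | ⊢? (Z ∪ (P - g)) f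
    ... | _       | yes ⊢f = ⊢f
    ... | yes g∈X | no _   = ⊢-mono (∪-least id (⁅⁆⊆ g∈X) ∘ ∪-⊆-∪⁅⁆) ZP⊢f
    ... | no g∉X  | no ⊬f  = contradiction (⊢-mono X∪f⊆ (exchange ⊬f (⊢-mono ∪-⊆-∪⁅⁆ ZP⊢f))) (col g∈P)
      where
      X∪f⊆ : (Z ∪ (P - g)) ∪ ⁅ f ⁆ ⊆ U - g
      X∪f⊆ = ∪-least
        (λ x∈ → x∈p∧x≢y⇒x∈p-y (∪-least Z⊆U (P⊆U ∘ -⊆) x∈) λ { refl → g∉X x∈ })
        (⁅⁆⊆ (x∈p∧x≢y⇒x∈p-y f∈U λ { refl → f∉P g∈P }))

  -- Each `g ∈ P` raises the rank by one when it is added, because what precedes it lies in `U - g`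
  -- and cannot span it.
  coloop-r-∪ : ∀ P → (∀ {g} → g ∈ P → Coloop U g) → Z ⊆ U → P ⊆ U →
    (∀ {x} → x ∈ P → x ∉ Z) → r M Z + ∣ P ∣ ≤ r M (Z ∪ P)
  coloop-r-∪ {U} {Z} = subset-induction
    (λ P → (∀ {g} → g ∈ P → Coloop U g) → Z ⊆ U → P ⊆ U → (∀ {x} → x ∈ P → x ∉ Z) →
      r M Z + ∣ P ∣ ≤ r M (Z ∪ P))
    (λ {P} empty _ _ _ _ → begin
      r M Z + ∣ P ∣   ≡⟨ cong (λ p → r M Z + ∣ p ∣) (Empty-unique empty) ⟩
      r M Z + ∣ ∅ {n} ∣  ≡⟨ cong (r M Z +_) (∣⊥∣≡0 n) ⟩
      r M Z + 0       ≡⟨ +-identityʳ _ ⟩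
      r M Z           ≤⟨ r-mono M ∪ˡ ⟩
      r M (Z ∪ P)     ∎)
    λ {P} {g} g∈P ih col Z⊆U P⊆U disj → begin
      r M Z + ∣ P ∣                    ≤⟨ +-monoʳ-≤ (r M Z) (p⊆q⇒∣p∣≤∣q∣ (⊆-∪⁅⁆ {X = P} {g})) ⟩
      r M Z + ∣ (P - g) ∪ ⁅ g ⁆ ∣      ≤⟨ +-monoʳ-≤ (r M Z) (∣p∪q∣≤∣p∣+∣q∣ (P - g) ⁅ g ⁆) ⟩
      r M Z + (∣ P - g ∣ + ∣ ⁅ g ⁆ ∣)  ≡⟨ cong (λ s → r M Z + (∣ P - g ∣ + s)) (∣⁅x⁆∣≡1 g) ⟩
      r M Z + (∣ P - g ∣ + 1)          ≡⟨ +-assoc (r M Z) _ 1 ⟨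
      r M Z + ∣ P - g ∣ + 1            ≡⟨ +-comm _ 1 ⟩
      suc (r M Z + ∣ P - g ∣)          ≤⟨ s≤s (ih (col ∘ -⊆) Z⊆U (P⊆U ∘ -⊆) (disj ∘ -⊆)) ⟩
      suc (r M (Z ∪ (P - g)))          ≤⟨ ≰⇒> (col g∈P ∘ ⊢-mono (λ x∈ →
                                            x∈p∧x≢y⇒x∈p-y (∪-least Z⊆U (P⊆U ∘ -⊆) x∈)
                                              λ { refl → [ disj g∈P , (λ g∈ → ∈-⇒≢ g∈ refl) ]′ (x∈p∪q⁻ Z (P - g) x∈) })) ⟩
      r M ((Z ∪ (P - g)) ∪ ⁅ g ⁆)      ≤⟨ r-mono M (∪-least (∪-mono id -⊆) (∪ʳ ∘ ⁅⁆⊆ g∈P)) ⟩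
      r M (Z ∪ P)                      ∎
    where open ≤-Reasoning

-- Finite sums and indicator counts.

sum-const : ∀ n c → sum {n} (λ _ → c) ≡ n * c
sum-const zero    c = refl
sum-const (suc n) c = cong (c +_) (sum-const n c)

sum-mono-≤ : ∀ {n} {f g : Fin n → ℕ} → (∀ i → f i ≤ g i) → sum f ≤ sum g
sum-mono-≤ {zero}  f≤g = z≤n
sum-mono-≤ {suc n} f≤g = +-mono-≤ (f≤g zero) (sum-mono-≤ (f≤g ∘ suc))

-- A strict inequality at a single index would make the sums differ. This turns every extremal total
-- below into equalities at each time.
sum-≤⇒≥ : ∀ {n} {f g : Fin n → ℕ} → (∀ i → f i ≤ g i) → sum g ≤ sum f → ∀ i → g i ≤ f i
sum-≤⇒≥ {suc n} {f} {g} f≤g Σg≤Σf zero = +-cancelʳ-≤ (sum (g ∘ suc)) _ _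
  (≤-trans Σg≤Σf (+-monoʳ-≤ (f zero) (sum-mono-≤ (f≤g ∘ suc))))
sum-≤⇒≥ {suc n} {f} {g} f≤g Σg≤Σf (suc i) = sum-≤⇒≥ (f≤g ∘ suc)
  (+-cancelˡ-≤ (g zero) _ _ (≤-trans Σg≤Σf (+-monoˡ-≤ (sum (f ∘ suc)) (f≤g zero)))) i

sum-shift : ∀ m (f : ℕ → ℕ) → f (suc m) ≡ f 0 →
  sum {suc m} (f ∘ suc ∘ toℕ) ≡ sum {suc m} (f ∘ toℕ)
sum-shift m f eq = begin
  sum {suc m} (f ∘ suc ∘ toℕ)
    ≡⟨ sum-init-last {m} (f ∘ suc ∘ toℕ) ⟩
  sum {m} (f ∘ suc ∘ toℕ ∘ inject₁) + f (suc (toℕ (fromℕ m)))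
    ≡⟨ cong₂ _+_ (sum-cong-≗ {m} λ i → cong (f ∘ suc) (Fin.toℕ-inject₁ i))
                 (trans (cong (f ∘ suc) (Fin.toℕ-fromℕ m)) eq) ⟩
  sum {m} (f ∘ suc ∘ toℕ) + f 0
    ≡⟨ +-comm _ (f 0) ⟩
  f 0 + sum {m} (f ∘ suc ∘ toℕ) ∎
  where open ≡-Reasoning

𝟙 : Bool → ℕ
𝟙 true  = 1
𝟙 false = 0

∣p∣≡sum : ∀ {n} (p : Subset n) → ∣ p ∣ ≡ sum (𝟙 ∘ lookup p)
∣p∣≡sum []          = refl
∣p∣≡sum (true ∷ p)  = cong suc (∣p∣≡sum p)
∣p∣≡sum (false ∷ p) = ∣p∣≡sum p

module _ {n} {P : Fin n → Set} (P? : Decidable P) where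

  ⟪_⟫ : Subset n
  ⟪_⟫ = tabulate (does ∘ P?)

  ∈⟪⟫⁺ : ∀ {e} → P e → e ∈ ⟪_⟫
  ∈⟪⟫⁺ {e} Pe = lookup⇒[]= e _ (trans (lookup∘tabulate _ e) (dec-true (P? e) Pe))

  ∈⟪⟫⁻ : ∀ {e} → e ∈ ⟪_⟫ → P e
  ∈⟪⟫⁻ {e} e∈ with P? e | trans (sym (lookup∘tabulate (does ∘ P?) e)) ([]=⇒lookup e∈)
  ... | yes Pe | _ = Pe

  ∣⟪⟫∣ : ∣ ⟪_⟫ ∣ ≡ sum (𝟙 ∘ does ∘ P?)
  ∣⟪⟫∣ = trans (∣p∣≡sum ⟪_⟫) (sum-cong-≗ λ e → cong 𝟙 (lookup∘tabulate (does ∘ P?) e))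

-- Residues and cyclic shifts modulo `n`.

module Mod (m : ℕ) where

  private
    n = suc m

  -- Modulo n, a * m is the additive inverse of a.
  %-cancelˡ : ∀ a x y → (a + x) % n ≡ (a + y) % n → x % n ≡ y % n
  %-cancelˡ a x y eq = trans (sym (recover x)) (trans (cong (λ t → (t + (a * m) % n) % n) eq) (recover y))
    where
    open ≡-Reasoning
    recover : ∀ x → ((a + x) % n + (a * m) % n) % n ≡ x % n
    recover x = begin
      ((a + x) % n + (a * m) % n) % n  ≡⟨ %-distribˡ-+ (a + x) (a * m) n ⟨
      (a + x + a * m) % n              ≡⟨ cong (_% n) (trans (cong (_+ a * m) (+-comm a x)) (trans (+-assoc x a (a * m)) (cong (x +_) (sym (*-suc a m))))) ⟩
      (x + a * n) % n                  ≡⟨ [m+kn]%n≡m%n x a n ⟩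
      x % n                            ∎

  %-congʳ-+ : ∀ a x y → x % n ≡ y % n → (a + x) % n ≡ (a + y) % n
  %-congʳ-+ a x y eq = trans (%-distribˡ-+ a x n)
    (trans (cong (λ t → (a % n + t) % n) eq) (sym (%-distribˡ-+ a y n)))

  suc-% : ∀ a → suc (a % n) < n → suc a % n ≡ suc (a % n)
  suc-% a lt = trans (%-congʳ-+ 1 a (a % n) (sym (m%n%n≡m%n a n))) (m<n⇒m%n≡m lt)

  suc-%-wrap : ∀ a → suc (a % n) ≡ n → suc a % n ≡ 0
  suc-%-wrap a eq = trans (%-congʳ-+ 1 a (a % n) (sym (m%n%n≡m%n a n)))
    (trans (cong (_% n) eq) (n%n≡0 n))

  -- By induction on `a`: each unit shift only moves the first term of a full period to its end.
  count-shift : ∀ (g : ℕ → ℕ) a →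
    sum {n} (λ i → g ((a + toℕ i) % n)) ≡ sum {n} (λ i → g (toℕ i))
  count-shift g zero    = sum-cong-≗ {n} λ i → cong g (m<n⇒m%n≡m (Fin.toℕ<n i))
  count-shift g (suc a) = trans
    (sum-cong-≗ {n} λ i → cong (λ t → g (t % n)) (sym (+-suc a (toℕ i))))
    (trans (sum-shift m (λ i → g ((a + i) % n))
             (cong g (trans ([m+n]%n≡m%n a n) (cong (_% n) (sym (+-identityʳ a))))))
           (count-shift g a))

  count-< : ∀ k → k ≤ n → sum {n} (λ i → 𝟙 (does (toℕ i <? k))) ≡ k
  count-< k = go k n
    where
    go : ∀ k n → k ≤ n → sum {n} (λ i → 𝟙 (does (toℕ i <? k))) ≡ k
    go zero    n       z≤n       = trans (sum-const n 0) (*-zeroʳ n)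
    go (suc k) (suc n) (s≤s k≤n) = cong suc (go k n k≤n)

  -- Going from time i to i + 1, an arc of length k + 1 is left at offset k and entered at offset m.
  arc-step : ∀ {k} → k ≤ m → ∀ a → 𝟙 (does (suc a % n <? suc k)) + 𝟙 (does (a % n ≟ k)) ≡
                                   𝟙 (does (a % n <? suc k)) + 𝟙 (does (a % n ≟ m))
  arc-step {k} k≤m a with m≤n⇒m<n∨m≡n (m%n<n a n)
  -- Here the offset is `m`. It is active only if `k = m`, that is, if the arc covers all times;
  -- then it is left and entered at once.
  ... | inj₂ wrap
    rewrite suc-%-wrap a wrap | suc-injective wrap | dec-true (m ≟ m) refl =
    trans (cong (λ b → suc (𝟙 b)) (does-⇔ (mk⇔ (λ { refl → n<1+n m })
      (λ m<1+k → ≤-antisym (s≤s⁻¹ m<1+k) k≤m)) (m ≟ k) (m <? suc k)))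
      (+-comm 1 _)
  ... | inj₁ lt
    rewrite suc-% a lt | dec-false (a % n ≟ m) (λ eq → <⇒≢ lt (cong suc eq)) with <-cmp (a % n) k
  ...   | tri< t<k t≢k _
    rewrite dec-true (suc (a % n) <? suc k) (s≤s t<k) | dec-false (a % n ≟ k) t≢k
          | dec-true (a % n <? suc k) (m<n⇒m<1+n t<k) = refl
  ...   | tri≈ t≮k t≡k _
    rewrite dec-false (suc (a % n) <? suc k) (t≮k ∘ s≤s⁻¹) | dec-true (a % n ≟ k) t≡k
          | dec-true (a % n <? suc k) (s≤s (≤-reflexive t≡k)) = refl
  ...   | tri> t≮k t≢k t>k
    rewrite dec-false (suc (a % n) <? suc k) (t≮k ∘ s≤s⁻¹) | dec-false (a % n ≟ k) t≢k
          | dec-false (a % n <? suc k) (<⇒≱ (s≤s t>k)) = refl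

-- Cyclic arcs of length `k` and their double count.

module Arc (m k : ℕ) (k≤n : k ≤ suc m) where

  open Mod m public

  private
    n = suc m

  inArc? : ∀ (c : Fin n → ℕ) i → Decidable (λ e → (c e + i) % n < k)
  inArc? c i e = (c e + i) % n <? k

  -- Opaque so that unification recovers c and i from I c i.
  opaque
    I : (Fin n → ℕ) → ℕ → Subset n
    I c i = ⟪ inArc? c i ⟫

    ∈I⁺ : ∀ {c i e} → (c e + i) % n < k → e ∈ I c i
    ∈I⁺ {c} {i} = ∈⟪⟫⁺ (inArc? c i)

    ∈I⁻ : ∀ {c i e} → e ∈ I c i → (c e + i) % n < k
    ∈I⁻ {c} {i} = ∈⟪⟫⁻ (inArc? c i)

    I-cong : ∀ c c′ i j → (∀ e → (c e + i) % n ≡ (c′ e + j) % n) → I c i ≡ I c′ j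
    I-cong c c′ i j eq = tabulate-cong λ e → cong (λ t → does (t <? k)) (eq e)

    ∣I∣ : ∀ c i → ∣ I c i ∣ ≡ sum {n} (λ e → 𝟙 (does (inArc? c i e)))
    ∣I∣ c i = ∣⟪⟫∣ (inArc? c i)

    -- Incidences of times and elements, counted by elements: each is active at exactly `k` of any
    -- `n` consecutive times.
    sum-∣I∩∣ : ∀ c s (A : Subset n) → sum {n} (λ i → ∣ I c (s + toℕ i) ∩ A ∣) ≡ k * ∣ A ∣
    sum-∣I∩∣ c s A = begin
      sum {n} (λ i → ∣ I c (s + toℕ i) ∩ A ∣)
        ≡⟨ sum-cong-≗ {n} (λ i → trans (∣p∣≡sum (I c (s + toℕ i) ∩ A)) (sum-cong-≗ {n} (incidence i))) ⟩
      sum {n} (λ i → sum {n} λ e → 𝟙 (inside? i e ∧ lookup A e))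
        ≡⟨ ∑-comm {n} {n} (λ i e → 𝟙 (inside? i e ∧ lookup A e)) ⟩
      sum {n} (λ e → sum {n} λ i → 𝟙 (inside? i e ∧ lookup A e))
        ≡⟨ sum-cong-≗ {n} (λ e → arcLength e (lookup A e)) ⟩
      sum {n} (λ e → k * 𝟙 (lookup A e))
        ≡⟨ *-distribˡ-sum {n} k (𝟙 ∘ lookup A) ⟨
      k * sum (𝟙 ∘ lookup A)
        ≡⟨ cong (k *_) (∣p∣≡sum A) ⟨
      k * ∣ A ∣ ∎
      where
      open ≡-Reasoning
      inside? : Fin n → Fin n → Bool
      inside? i e = does ((c e + s + toℕ i) % n <? k)
      incidence : ∀ i e → 𝟙 (lookup (I c (s + toℕ i) ∩ A) e) ≡ 𝟙 (inside? i e ∧ lookup A e)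
      incidence i e = cong 𝟙 (trans (lookup-zipWith _∧_ e (I c (s + toℕ i)) A)
        (cong (_∧ lookup A e) (trans (lookup∘tabulate (does ∘ inArc? c (s + toℕ i)) e)
          (cong (λ t → does (t % n <? k)) (sym (+-assoc (c e) s (toℕ i)))))))
      arcLength : ∀ e b → sum {n} (λ i → 𝟙 (inside? i e ∧ b)) ≡ k * 𝟙 b
      arcLength e true  = trans (sum-cong-≗ {n} λ i → cong 𝟙 (∧-identityʳ (inside? i e)))
        (trans (count-shift (λ t → 𝟙 (does (t <? k))) (c e + s))
          (trans (count-< k k≤n) (sym (*-identityʳ k))))
      arcLength e false = trans (sum-cong-≗ {n} λ i → cong 𝟙 (∧-zeroʳ (inside? i e)))
        (trans (sum-const n 0) (trans (*-zeroʳ n) (sym (*-zeroʳ k))))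

  I-cong-% : ∀ c i j → i % n ≡ j % n → I c i ≡ I c j
  I-cong-% c i j eq = I-cong c c i j λ e → %-congʳ-+ (c e) i j eq

-- Moves of arcs and states of maximal total rank.

rank≤n : ∀ {n} (M : Matroid n) → rankM M ≤ n
rank≤n {n} M = ≤-trans (r-bound M ⊤) (≤-reflexive (∣⊤∣≡n n))

module Core {m : ℕ} (M : Matroid (suc m)) where

  n k : ℕ
  n = suc m
  k = rankM M

  open Closure M
  open Arc m k (rank≤n M)

  -- In state c the element e is active at the times i with (c e + i) mod n < k;
  -- incrementing c e moves its arc of active times back by one.
  State : Set
  State = Fin n → ℕ

  total : State → ℕ
  total c = sum {n} λ i → r M (I c (toℕ i))

  suc-%-< : ∀ a → a % n < k → suc (a % n) ≡ k ⊎ suc a % n < k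
  suc-%-< a t<k with m≤n⇒m<n∨m≡n t<k
  ... | inj₂ eq = inj₁ eq
  ... | inj₁ lt = inj₂ (subst (_< k) (sym (suc-% a (<-≤-trans lt (rank≤n M)))) lt)

  I-mod : ∀ c i → I c i ≡ I c (toℕ (i mod n))
  I-mod c i = I-cong-% c i _ (trans (sym (m%n%n≡m%n i n)) (cong (_% n) (sym (Fin.toℕ-fromℕ< (m%n<n i n)))))

  -- q is the last active time of e; being spanned there, e may leave without loss of rank.
  Movable : State → Fin n → Set
  Movable c e = Σ[ q ∈ ℕ ] (suc ((c e + q) % n) ≡ k × (I c q - e ⊢ e))

  bump : State → Fin n → State
  bump c e = updateAt c e suc

  bump-≢ : ∀ c {e x} → x ≢ e → bump c e x ≡ c x
  bump-≢ c {e} {x} x≢e = updateAt-minimal x e c x≢e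

  infix 4 _↝_
  data _↝_ : State → State → Set where
    done : ∀ {c} → c ↝ c
    move : ∀ {c d} e → Movable c e → bump c e ↝ d → c ↝ d

  ↝-trans : ∀ {c d z} → c ↝ d → d ↝ z → c ↝ z
  ↝-trans done          q = q
  ↝-trans (move e mv p) q = move e mv (↝-trans p q)

  -- Quantified over all reachable states, so that it persists along moves.
  Dead : State → Fin n → Set
  Dead c f = ∀ {d} → c ↝ d → ¬ Movable d f

  module Bump (c : State) (e : Fin n) where

    c′ : State
    c′ = bump c e

    enter : ∀ {i x} → x ≢ e → x ∈ I c′ i → x ∈ I c i
    enter {i} x≢e x∈ = ∈I⁺
      (subst (λ t → (t + i) % n < k) (bump-≢ c x≢e) (∈I⁻ x∈))

    stay : ∀ {i x} → x ≢ e → x ∈ I c i → x ∈ I c′ i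
    stay {i} x≢e x∈ = ∈I⁺
      (subst (λ t → (t + i) % n < k) (sym (bump-≢ c x≢e)) (∈I⁻ x∈))

    leave : ∀ {i} → e ∈ I c i → suc ((c e + i) % n) ≡ k ⊎ e ∈ I c′ i
    leave {i} e∈ with suc-%-< (c e + i) (∈I⁻ e∈)
    ... | inj₁ eq = inj₁ eq
    ... | inj₂ lt = inj₂ (∈I⁺
            (subst (λ t → (t + i) % n < k) (sym (updateAt-updates e c)) lt))

    I′⊆ : ∀ {i} → I c′ i ⊆ I c i ∪ ⁅ e ⁆
    I′⊆ {i} {x} x∈ with x Fin.≟ e
    ... | yes refl = ∪ʳ (x∈⁅x⁆ x)
    ... | no  x≢e  = ∪ˡ (enter x≢e x∈)

    I⊆ : ∀ {i} → e ∈ I c′ i → I c i ⊆ I c′ i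
    I⊆ e∈ {x} x∈ with x Fin.≟ e
    ... | yes refl = e∈
    ... | no  x≢e  = stay x≢e x∈

    I′⊆I : ∀ {i} → e ∉ I c′ i → I c′ i ⊆ I c i
    I′⊆I e∉ x∈ = enter (λ { refl → e∉ x∈ }) x∈

    -- Only `e` changes its active times, and the one it leaves is congruent to `q`, where the other
    -- active elements span it.
    rank-≤ : Movable c e → ∀ i → r M (I c i) ≤ r M (I c′ i)
    rank-≤ (q , end , q⊢e) i with e ∈? I c′ i | e ∈? I c i
    ... | yes e∈ | _      = r-mono M (I⊆ e∈)
    ... | no  e∉ | no e∉I = r-mono M λ x∈ → stay (λ { refl → e∉I x∈ }) x∈
    ... | no  e∉ | yes e∈ with leave e∈
    ...   | inj₂ e∈′ = contradiction e∈′ e∉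
    ...   | inj₁ eq  = begin
      r M (I c i)                ≤⟨ r-mono M ⊆-∪⁅⁆ ⟩
      r M ((I c i - e) ∪ ⁅ e ⁆)  ≤⟨ subst (λ J → J - e ⊢ e) same q⊢e ⟩
      r M (I c i - e)            ≤⟨ r-mono M (λ x∈ → stay (∈-⇒≢ x∈) (-⊆ x∈)) ⟩
      r M (I c′ i)               ∎
      where
      open ≤-Reasoning
      same : I c q ≡ I c i
      same = I-cong-% c q i (%-cancelˡ (c e) q i (suc-injective (trans end (sym eq))))

    total-≤ : Movable c e → total c ≤ total c′
    total-≤ mv = sum-mono-≤ {n} λ i → rank-≤ mv (toℕ i)

    module _ (mv : Movable c e) (max : total c′ ≤ total c) where

      rank-≥ : ∀ i → r M (I c′ i) ≤ r M (I c i)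
      rank-≥ i = subst₂ (λ J J′ → r M J ≤ r M J′) (sym (I-mod c′ i)) (sym (I-mod c i))
        (sum-≤⇒≥ {n} (λ i → rank-≤ mv (toℕ i)) max (i mod n))

      -- By maximality the rank at `i` does not grow, yet `I c′ i` contains both `I c i` and `e`.
      spanned : ∀ {i} → e ∈ I c′ i → I c i ⊢ e
      spanned {i} e∈ = ≤-trans (r-mono M (∪-least (I⊆ e∈) (⁅⁆⊆ e∈))) (rank-≥ i)

      -- Either `e` is inactive at `i` after the move and `I c′ i ⊆ I c i`, or `e` is the only
      -- possible new element and `I c i` spans it.
      ⊢-back : ∀ {i g} → I c′ i ⊢ g → I c i ⊢ g
      ⊢-back {i} ⊢g with e ∈? I c′ i
      ... | yes e∈ = ⊢-cut (spanned e∈) (⊢-mono I′⊆ ⊢g)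
      ... | no  e∉ = ⊢-mono (I′⊆I e∉) ⊢g

      ⊢-back-minus : ∀ {q f g} → f ≢ e → ¬ (I c′ q - f ⊢ f) → I c′ q - f ⊢ g → I c q - f ⊢ g
      ⊢-back-minus {q} {f} f≢e ⊬f ⊢g with e ∈? I c′ q
      ... | no  e∉ = ⊢-mono (-mono (I′⊆I e∉)) ⊢g
      ... | yes e∈ = ⊢-cut without-f (⊢-mono cover ⊢g)
        where
        -- Otherwise exchange would make `f` spanned by `(I c q - f) ∪ ⁅ e ⁆`, which lies in
        -- `I c′ q - f`.
        without-f : I c q - f ⊢ e
        without-f = decidable-stable (⊢? _ _) λ ⊬e → ⊬f
          (⊢-mono (∪-least (-mono (I⊆ e∈)) (⁅⁆⊆ (x∈p∧x≢y⇒x∈p-y e∈ (f≢e ∘ sym))))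
            (exchange ⊬e (⊢-mono ⊆-∪⁅⁆ (spanned e∈))))
        cover : I c′ q - f ⊆ (I c q - f) ∪ ⁅ e ⁆
        cover {x} x∈ with x Fin.≟ e
        ... | yes refl = ∪ʳ (x∈⁅x⁆ x)
        ... | no  x≢e  = ∪ˡ (x∈p∧x≢y⇒x∈p-y (enter x≢e (-⊆ x∈)) (∈-⇒≢ x∈))

  -- Spanning is only transported backwards along moves: e ∈ I d i is trivially spanned by I d i.
  module Maximal (S : ℕ) (max : ∀ c → total c ≤ S) where

    total-↝ : ∀ {c d} → S ≤ total c → c ↝ d → S ≤ total d
    total-↝ S≤ done              = S≤
    total-↝ {c} S≤ (move e mv p) = total-↝ (≤-trans S≤ (Bump.total-≤ c e mv)) p

    ⊢-back* : ∀ {c d i g} → S ≤ total c → c ↝ d → I d i ⊢ g → I c i ⊢ g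
    ⊢-back* S≤ done              ⊢g = ⊢g
    ⊢-back* {c} S≤ (move e mv p) ⊢g =
      Bump.⊢-back c e mv (≤-trans (max _) S≤) (⊢-back* (≤-trans S≤ (Bump.total-≤ c e mv)) p ⊢g)

    -- A dead `f` is never moved, so its arc keeps ending at `q`; were it spanned by the others
    -- there, it would be movable. Hence `⊢-back-minus` applies to every move.
    ⊢-back-minus* : ∀ {c d f q g} → S ≤ total c → Dead c f → suc ((c f + q) % n) ≡ k →
      c ↝ d → I d q - f ⊢ g → I c q - f ⊢ g
    ⊢-back-minus* S≤ dead end done ⊢g = ⊢g
    ⊢-back-minus* {c} {f = f} {q} S≤ dead end (move e mv p) ⊢g =
      Bump.⊢-back-minus c e mv (≤-trans (max _) S≤) f≢e (λ ⊢f → dead (move e mv done) (q , end′ , ⊢f))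
        (⊢-back-minus* (≤-trans S≤ (Bump.total-≤ c e mv)) (dead ∘ move e mv) end′ p ⊢g)
      where
      f≢e : f ≢ e
      f≢e refl = dead done mv
      end′ : suc ((bump c e f + q) % n) ≡ k
      end′ = subst (λ t → suc ((t + q) % n) ≡ k) (sym (bump-≢ c f≢e)) end

  -- Stop after the first move of `e` on the way to `d`, or perform the move available at `d` if
  -- there was none.
  first-move : ∀ {c d e} → c ↝ d → Movable d e → Σ[ z ∈ State ] (c ↝ z × z e ≡ suc (c e))
  first-move {c} {e = e} done mv = bump c e , move e mv done , updateAt-updates e c
  first-move {c} {e = e} (move g mv′ p) mv with e Fin.≟ g
  ... | yes refl = bump c e , move e mv′ done , updateAt-updates e c
  ... | no  e≢g  with z , q , eq ← first-move p mv =
    z , move g mv′ q , trans eq (cong suc (bump-≢ c e≢g))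

  module _ {c : State} {e : Fin n} (alive : ∀ {d} → c ↝ d → ¬ Dead d e) where

    -- The value at `e` rises one move at a time, as `e` becomes movable again from any reachable
    -- state. Double negation is due to `Dead` being a negative, undecided statement.
    reach : ∀ j → ¬ ¬ (Σ[ d ∈ State ] (c ↝ d × d e ≡ j + c e))
    reach zero    none = none (c , done , refl)
    reach (suc j) none = reach j λ (d , p , eq) → alive p λ q mv →
      let z , p′ , eq′ = first-move q mv in none (z , ↝-trans p p′ , trans eq′ (cong suc eq))

    reach-position : 0 < k → ∀ i → ¬ ¬ (Σ[ d ∈ State ] (c ↝ d × e ∈ I d i))
    -- Since `m` is `-1` modulo `n`, this many moves of `e` cancel `c e + i` and bring the start of
    -- its arc to time `i`.
    reach-position 0<k i none = reach ((c e + i) * m) λ (d , p , eq) →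
      none (d , p , ∈I⁺ (subst (_< k) (sym (at-start d eq)) 0<k))
      where
      open ≡-Reasoning
      at-start : ∀ d → d e ≡ (c e + i) * m + c e → (d e + i) % n ≡ 0
      at-start d eq = begin
        (d e + i) % n                      ≡⟨ cong (λ t → (t + i) % n) eq ⟩
        ((c e + i) * m + c e + i) % n      ≡⟨ cong (_% n) (+-assoc ((c e + i) * m) (c e) i) ⟩
        ((c e + i) * m + (c e + i)) % n    ≡⟨ cong (_% n) (+-comm ((c e + i) * m) (c e + i)) ⟩
        (c e + i + (c e + i) * m) % n      ≡⟨ cong (_% n) (*-suc (c e + i) m) ⟨
        ((c e + i) * n) % n                ≡⟨ m*n%n≡0 (c e + i) n ⟩
        0                                  ∎

  -- The rank bound when the elements of `D` are frozen.

  module Frozen (c : State) (D : Subset n)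
    (spans      : ∀ {e} → e ∉ D → ∀ i → I c i ⊢ e)
    (spans-end  : ∀ {f e} → f ∈ D → e ∉ D → ∀ i → suc ((c f + i) % n) ≡ k → I c i - f ⊢ e)
    (coloop-end : ∀ {f} → f ∈ D → ∀ i → suc ((c f + i) % n) ≡ k → Coloop (I c i) f) where

    -- A circuit in ∁ D ∪ I c i through f ∈ D cannot contain any g ∈ D whose arc ends at i
    -- (coloop-U-end), so it persists at time i + 1, and so on until the arc of f ends.
    U : ℕ → Subset n
    U i = ∁ D ∪ I c i

    -- All of `∁ D` is spanned by `I c i - f`, so joining it does not enlarge the closure.
    coloop-U-end : ∀ {f} i → f ∈ D → suc ((c f + i) % n) ≡ k → Coloop (U i) f
    coloop-U-end {f} i f∈D end U⊢f = coloop-end f∈D i end (begin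
      r M ((I c i - f) ∪ ⁅ f ⁆)          ≤⟨ r-mono M (∪-mono ∪ˡ id) ⟩
      r M (((I c i - f) ∪ ∁ D) ∪ ⁅ f ⁆)  ≤⟨ ⊢-mono U-f⊆ U⊢f ⟩
      r M ((I c i - f) ∪ ∁ D)            ≤⟨ r-∪-spanned (∁ D) (λ e∈ → spans-end f∈D (x∈∁p⇒x∉p e∈) i end) ⟩
      r M (I c i - f)                    ∎)
      where
      open ≤-Reasoning
      U-f⊆ : U i - f ⊆ (I c i - f) ∪ ∁ D
      U-f⊆ x∈ = [ ∪ʳ , (λ x∈I → ∪ˡ (x∈p∧x≢y⇒x∈p-y x∈I (∈-⇒≢ x∈))) ]′ (x∈p∪q⁻ (∁ D) (I c i) (-⊆ x∈))

    -- Induction on `d`, the number of steps left until the last active time of `f`.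
    coloop-U : ∀ d {f} i → f ∈ D → (c f + i) % n + suc d ≡ k → Coloop (U i) f
    coloop-U zero    i f∈D eq = coloop-U-end i f∈D (trans (+-comm 1 _) eq)
    coloop-U (suc d) {f} i f∈D eq U⊢f =
      -- `P` collects the elements of `D` whose arcs end at `i`. They are coloops and are stripped;
      -- everything else in `U i` is still in `U (suc i)`.
      coloop-U d (suc i) f∈D eq′ (⊢-mono (-mono (p∩q⊆q (U i) (U (suc i))))
        (coloop-strip P (λ g∈ → coloop-U-end i (proj₁ (P⁻ g∈)) (proj₂ (P⁻ g∈)))
          (p∩q⊆p (U i) (U (suc i)) ∘ -⊆) P⊆U (∪ʳ (∈I⁺ t<k))
          (λ f∈P → <⇒≢ 1+t<k (proj₂ (P⁻ f∈P)))
          (⊢-mono cover U⊢f)))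
      where
      P? : ∀ g → Dec (g ∈ D × suc ((c g + i) % n) ≡ k)
      P? g = (g ∈? D) ×-dec (suc ((c g + i) % n) ≟ k)
      P : Subset n
      P = ⟪ P? ⟫
      P⁻ : ∀ {g} → g ∈ P → g ∈ D × suc ((c g + i) % n) ≡ k
      P⁻ = ∈⟪⟫⁻ P?
      P⊆U : P ⊆ U i
      P⊆U g∈ = ∪ʳ (∈I⁺ (≤-reflexive (proj₂ (P⁻ g∈))))
      1+t<k : suc ((c f + i) % n) < k
      1+t<k = ≤-trans (≤-reflexive (+-comm 2 _)) (≤-trans (+-monoʳ-≤ _ (s≤s (s≤s z≤n))) (≤-reflexive eq))
      t<k : (c f + i) % n < k
      t<k = <-trans (n<1+n _) 1+t<k
      eq′ : (c f + suc i) % n + suc d ≡ k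
      eq′ = trans (cong (_+ suc d) (trans (cong (_% n) (+-suc (c f) i))
              (suc-% (c f + i) (<-≤-trans 1+t<k (rank≤n M)))))
            (trans (sym (+-suc _ (suc d))) eq)
      cover : U i - f ⊆ (U i ∩ U (suc i) - f) ∪ P
      cover {x} x∈ with x ∈? U (suc i) | x∈p∪q⁻ (∁ D) (I c i) (-⊆ x∈)
      ... | yes x∈′ | _         = ∪ˡ (x∈p∧x≢y⇒x∈p-y (x∈p∩q⁺ (-⊆ x∈ , x∈′)) (∈-⇒≢ x∈))
      ... | no  x∉  | inj₁ x∈∁D = contradiction (∪ˡ x∈∁D) x∉
      ... | no  x∉  | inj₂ x∈I with suc-%-< (c x + i) (∈I⁻ x∈I)
      ...   | inj₁ end = ∪ʳ (∈⟪⟫⁺ P? (x∉∁p⇒x∈p (x∉ ∘ ∪ˡ) , end))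
      ...   | inj₂ lt  = contradiction
                (∪ʳ (∈I⁺ (subst (λ t → t % n < k) (sym (+-suc (c x) i)) lt))) x∉

    rank-≥ : ∀ i → r M (∁ D) + ∣ I c i ∩ D ∣ ≤ r M (I c i)
    rank-≥ i = begin
      r M (∁ D) + ∣ I c i ∩ D ∣  ≤⟨ coloop-r-∪ {U = U i} (I c i ∩ D) coloops ∪ˡ (∪ʳ ∘ p∩q⊆p (I c i) D)
                                      (λ x∈ → x∈p⇒x∉∁p (p∩q⊆q (I c i) D x∈)) ⟩
      r M (∁ D ∪ (I c i ∩ D))    ≤⟨ r-mono M (∪-least ∪ʳ (∪ˡ ∘ p∩q⊆p (I c i) D)) ⟩
      r M (I c i ∪ ∁ D)          ≤⟨ r-∪-spanned (∁ D) (λ e∈ → spans (x∈∁p⇒x∉p e∈) i) ⟩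
      r M (I c i)                ∎
      where
      open ≤-Reasoning
      coloops : ∀ {g} → g ∈ I c i ∩ D → Coloop (U i) g
      coloops {g} g∈ with g∈I , g∈D ← x∈p∩q⁻ (I c i) D g∈ =
        coloop-U (k ∸ suc ((c g + i) % n)) i g∈D
          (trans (+-suc _ _) (m+[n∸m]≡n (∈I⁻ g∈I)))

    n*k≤total : UniformDensity M → n * k ≤ total c
    n*k≤total density = begin
      n * k                                                  ≡⟨ cong (_* k) (∣⊤∣≡n n) ⟨
      ∣ ⊤ {n} ∣ * k                                          ≡⟨ cong (λ p → ∣ p ∣ * k) (p∪∁p≡⊤ D) ⟨
      ∣ D ∪ ∁ D ∣ * k                                        ≤⟨ *-monoˡ-≤ k (∣p∪q∣≤∣p∣+∣q∣ D (∁ D)) ⟩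
      (∣ D ∣ + ∣ ∁ D ∣) * k                                  ≡⟨ *-distribʳ-+ k ∣ D ∣ ∣ ∁ D ∣ ⟩
      ∣ D ∣ * k + ∣ ∁ D ∣ * k                                ≡⟨ +-comm (∣ D ∣ * k) _ ⟩
      ∣ ∁ D ∣ * k + ∣ D ∣ * k                                ≤⟨ +-mono-≤ dense (≤-reflexive (*-comm ∣ D ∣ k)) ⟩
      n * r M (∁ D) + k * ∣ D ∣                              ≡⟨ cong₂ _+_ (sum-const n (r M (∁ D))) (sum-∣I∩∣ c 0 D) ⟨
      sum {n} (λ _ → r M (∁ D)) + sum {n} (λ i → ∣ I c (toℕ i) ∩ D ∣)
                                                             ≡⟨ ∑-distrib-+ {n} (λ _ → r M (∁ D)) (λ i → ∣ I c (toℕ i) ∩ D ∣) ⟨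
      sum {n} (λ i → r M (∁ D) + ∣ I c (toℕ i) ∩ D ∣)        ≤⟨ sum-mono-≤ {n} (λ i → rank-≥ (toℕ i)) ⟩
      total c                                                ∎
      where
      open ≤-Reasoning
      dense : ∣ ∁ D ∣ * k ≤ n * r M (∁ D)
      -- The density bound covers nonempty sets; for empty `∁ D` the left side is zero.
      dense with nonempty? (∁ D)
      ... | yes ne    = density (∁ D) ne
      ... | no  empty = ≤-trans (≤-reflexive (cong (_* k)
              (trans (cong ∣_∣ (Empty-unique empty)) (∣⊥∣≡0 n)))) z≤n

  -- Existence of a good state, up to double negation.

  Good : State → Set
  Good c = ∀ (i : Fin n) → k ≤ r M (I c (toℕ i))

  n*k≤total⇒Good : ∀ {c} → n * k ≤ total c → Good c
  n*k≤total⇒Good {c} le = sum-≤⇒≥ {n} (λ i → r-mono M {I c (toℕ i)} ⊆⊤) (≤-trans (≤-reflexive (sum-const n k)) le)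

  total≤n*k : ∀ c → total c ≤ n * k
  total≤n*k c = ≤-trans (sum-mono-≤ {n} λ i → r-mono M {I c (toℕ i)} ⊆⊤) (≤-reflexive (sum-const n k))

  module _ (0<k : 0 < k) (density : UniformDensity M) (none : ∀ c → ¬ Good c) where

    -- Induction on growing sets `D` of dead elements. If an element outside `D` were dead at a
    -- reachable state, the larger set would give the contradiction there; so none ever is, the
    -- hypotheses of `Frozen` hold, and `c` is good.
    no-maximal : ∀ S → (∀ c → total c ≤ S) → ∀ c → ¬ S ≤ total c
    no-maximal S max c S≤ = go (⊃-wellFounded ∅) c S≤ λ f∈ → contradiction f∈ ∉⊥
      where
      open Maximal S max
      go : ∀ {D} → Acc _⊃_ D → ∀ c → S ≤ total c → (∀ {f} → f ∈ D → Dead c f) → ⊥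
      go {D} (acc rec) c S≤ dead = none c (n*k≤total⇒Good (Frozen.n*k≤total c D spans spans-end coloop-end density))
        where
        alive : ∀ {e} → e ∉ D → ∀ {d} → c ↝ d → ¬ Dead d e
        alive {e} e∉D {d} p dead-e = go {D ∪ ⁅ e ⁆} (rec (∪ˡ , e , ∪ʳ (x∈⁅x⁆ e) , e∉D)) d (total-↝ S≤ p) λ {f} f∈ →
          [ (λ f∈D → dead f∈D ∘ ↝-trans p)
          , (λ f∈e → subst (Dead d) (sym (x∈⁅y⁆⇒x≡y e f∈e)) dead-e) ]′ (x∈p∪q⁻ D ⁅ e ⁆ f∈)
        spans : ∀ {e} → e ∉ D → ∀ i → I c i ⊢ e
        spans e∉D i = decidable-stable (⊢? _ _) λ ⊬e → reach-position (alive e∉D) 0<k i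
          λ (d , p , e∈) → ⊬e (⊢-back* S≤ p (∈⇒⊢ e∈))
        spans-end : ∀ {f e} → f ∈ D → e ∉ D → ∀ i → suc ((c f + i) % n) ≡ k → I c i - f ⊢ e
        spans-end f∈D e∉D i end = decidable-stable (⊢? _ _) λ ⊬e → reach-position (alive e∉D) 0<k i
          λ (d , p , e∈) → ⊬e (⊢-back-minus* S≤ (dead f∈D) end p
            (∈⇒⊢ (x∈p∧x≢y⇒x∈p-y e∈ λ { refl → e∉D f∈D })))
        coloop-end : ∀ {f} → f ∈ D → ∀ i → suc ((c f + i) % n) ≡ k → Coloop (I c i) f
        coloop-end f∈D i end ⊢f = dead f∈D done (i , end , ⊢f)

    -- Replaces the choice of a maximising state: an upper bound attained by no state can be lowered
    -- by one, down to zero.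
    unbounded : ∀ S → ¬ (∀ c → total c ≤ S)
    unbounded zero    max = no-maximal zero max (λ _ → 0) z≤n
    unbounded (suc S) max = unbounded S λ c → s≤s⁻¹ (≰⇒> (no-maximal (suc S) max c))

  ¬∀¬Good : 0 < k → UniformDensity M → ¬ (∀ c → ¬ Good c)
  ¬∀¬Good 0<k density none = unbounded 0<k density none (n * k) total≤n*k

-- Functions with two coprime periods.

module _ {A : Set} (f : ℕ → A) where

  period-* : ∀ {p} → (∀ i → f (i + p) ≡ f i) → ∀ y i → f (i + y * p) ≡ f i
  period-* per zero    i = cong f (+-identityʳ i)
  period-* {p} per (suc y) i =
    trans (cong f (sym (+-assoc i p (y * p)))) (trans (period-* per y (i + p)) (per i))

  -- By Bézout, 1 is a difference of multiples of the two periods, hence itself a period.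
  coprime-periods⇒constant : ∀ {p q} → Coprime p q →
    (∀ i → f (i + p) ≡ f i) → (∀ i → f (i + q) ≡ f i) → ∀ i → f i ≡ f 0
  coprime-periods⇒constant {p} {q} cop per-p per-q = const
    where
    shift : ∀ {a b} → (∀ i → f (i + a) ≡ f i) → (∀ i → f (i + b) ≡ f i) →
      ∀ x y → 1 + y * b ≡ x * a → ∀ i → f (suc i) ≡ f i
    shift {a} {b} per-a per-b x y eq i = begin
      f (suc i)           ≡⟨ period-* per-b y (suc i) ⟨
      f (suc i + y * b)   ≡⟨ cong f (+-suc i (y * b)) ⟨
      f (i + suc (y * b)) ≡⟨ cong (λ t → f (i + t)) eq ⟩
      f (i + x * a)       ≡⟨ period-* per-a x i ⟩
      f i                 ∎
      where open ≡-Reasoning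
    step : ∀ i → f (suc i) ≡ f i
    step with coprime-Bézout cop
    ... | Bézout.+- x y eq = shift per-p per-q x y eq
    ... | Bézout.-+ x y eq = shift per-q per-p y x eq
    const : ∀ i → f i ≡ f 0
    const zero    = refl
    const (suc i) = trans (step i) (const i)

-- Finite injections and cyclic windows.

injective⇒surjective : ∀ {n} (g : Fin n → Fin n) → (∀ {x y} → g x ≡ g y → x ≡ y) →
  ∀ e → ∃ λ x → g x ≡ e
injective⇒surjective {n} g inj e with Fin.any? (λ x → g x Fin.≟ e)
... | yes hit = hit
-- Among `e` and the `n` values of `g` two coincide: either `e` is hit or injectivity fails.
... | no  miss with Fin.pigeonhole (n<1+n n) (λ { zero → e ; (suc x) → g x })
...   | zero  , suc j , _       , eq = contradiction (j , sym eq) miss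
...   | suc i , suc j , s<s i<j , eq = contradiction (cong toℕ (inj eq)) (<⇒≢ i<j)

∣window∣≤ : ∀ {n} (σ : Permutation′ n) i k → ∣ window σ i k ∣ ≤ k
∣window∣≤ {suc n} σ i zero    = ≤-reflexive (∣⊥∣≡0 (suc n))
∣window∣≤ {suc n} σ i (suc k) = begin
  ∣ window σ i k ∪ ⁅ s ⁆ ∣      ≤⟨ ∣p∪q∣≤∣p∣+∣q∣ (window σ i k) ⁅ s ⁆ ⟩
  ∣ window σ i k ∣ + ∣ ⁅ s ⁆ ∣  ≤⟨ +-mono-≤ (∣window∣≤ σ i k) (≤-reflexive (∣⁅x⁆∣≡1 s)) ⟩
  k + 1                         ≡⟨ +-comm k 1 ⟩
  suc k                         ∎
  where
  open ≤-Reasoning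
  s = σ ⟨$⟩ʳ ((toℕ i + k) mod suc n)

∈window : ∀ {m} (σ : Permutation′ (suc m)) i {j k} → j < k →
  σ ⟨$⟩ʳ ((toℕ i + j) mod suc m) ∈ window σ i k
∈window σ i {j} {suc k} (s≤s j≤k) with m≤n⇒m<n∨m≡n j≤k
... | inj₁ j<k  = ∪ˡ (∈window σ i j<k)
... | inj₂ refl = ∪ʳ (x∈⁅x⁆ _)

-- Active sets as windows of an ordering.

module CyclicOrdering {m : ℕ} (M : Matroid (suc m)) where

  open Core M
  open Closure M
  open Arc m (rankM M) (rank≤n M)

  -- The position of σ x is encoded as c (σ x) ≡ - 1 - x modulo n.
  I⊆window : (σ : Permutation′ n) (c : State) → (∀ x → (c (σ ⟨$⟩ʳ x) + toℕ x) % n ≡ m) →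
    ∀ i → I c (k + toℕ i) ⊆ window σ i k
  I⊆window σ c pos i {e} e∈ = subst (_∈ window σ i k)
    (trans (cong (σ ⟨$⟩ʳ_) at-x) (inverseʳ σ)) (∈window σ i j<k)
    where
    x = σ ⟨$⟩ˡ e
    t = (c e + (k + toℕ i)) % n
    -- With `c e ≡ -1 - x`, offset `t` at time `k + toℕ i` means `x ≡ i + (k - 1 - t)`; `lhs` and
    -- `rhs` verify this after adding `c e + suc t` to both sides.
    j = k ∸ suc t
    t<k : t < k
    t<k = ∈I⁻ e∈
    j+1+t≡k : j + suc t ≡ k
    j+1+t≡k = m∸n+n≡m t<k
    j<k : j < k
    j<k = ≤-trans (≤-reflexive (+-comm 1 j)) (≤-trans (+-monoʳ-≤ j (s≤s z≤n)) (≤-reflexive j+1+t≡k))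
    pos-e : (c e + toℕ x) % n ≡ m
    pos-e = subst (λ y → (c y + toℕ x) % n ≡ m) (inverseʳ σ) (pos x)
    open ≡-Reasoning
    lhs : (c e + suc t + (toℕ i + j)) % n ≡ t
    lhs = begin
      (c e + suc t + (toℕ i + j)) % n    ≡⟨ cong (_% n) (+-assoc (c e) (suc t) _) ⟩
      (c e + (suc t + (toℕ i + j))) % n  ≡⟨ cong (λ s → (c e + s) % n) (begin
        suc t + (toℕ i + j)  ≡⟨ +-comm (suc t) _ ⟩
        toℕ i + j + suc t    ≡⟨ +-assoc (toℕ i) j (suc t) ⟩
        toℕ i + (j + suc t)  ≡⟨ cong (toℕ i +_) j+1+t≡k ⟩
        toℕ i + k            ≡⟨ +-comm (toℕ i) k ⟩
        k + toℕ i            ∎) ⟩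
      t                                  ∎
    rhs : (c e + suc t + toℕ x) % n ≡ t
    rhs = begin
      (c e + suc t + toℕ x) % n      ≡⟨ cong (_% n) (begin
        c e + suc t + toℕ x      ≡⟨ cong (_+ toℕ x) (+-comm (c e) (suc t)) ⟩
        suc t + c e + toℕ x      ≡⟨ +-assoc (suc t) (c e) (toℕ x) ⟩
        suc t + (c e + toℕ x)    ≡⟨ +-suc t (c e + toℕ x) ⟨
        t + suc (c e + toℕ x)    ∎) ⟩
      (t + suc (c e + toℕ x)) % n    ≡⟨ %-congʳ-+ t (suc (c e + toℕ x)) 0 (suc-%-wrap (c e + toℕ x) (cong suc pos-e)) ⟩
      (t + 0) % n                    ≡⟨ cong (_% n) (+-identityʳ t) ⟩
      t % n                          ≡⟨ m%n%n≡m%n (c e + (k + toℕ i)) n ⟩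
      t                              ∎
    at-x : (toℕ i + j) mod n ≡ x
    at-x = Fin.toℕ-injective (begin
      toℕ ((toℕ i + j) mod n)  ≡⟨ Fin.toℕ-fromℕ< (m%n<n (toℕ i + j) n) ⟩
      (toℕ i + j) % n          ≡⟨ %-cancelˡ (c e + suc t) _ _ (trans lhs (sym rhs)) ⟩
      toℕ x % n                ≡⟨ m<n⇒m%n≡m (Fin.toℕ<n x) ⟩
      toℕ x                    ∎)

  -- From a base ordering to the density bound.

  ordering⇒density : HasCyclicBaseOrdering M → UniformDensity M
  ordering⇒density (σ , base) A _ = begin
    ∣ A ∣ * k                                 ≡⟨ *-comm ∣ A ∣ k ⟩
    k * ∣ A ∣                                 ≡⟨ sum-∣I∩∣ c k A ⟨
    sum {n} (λ i → ∣ I c (k + toℕ i) ∩ A ∣)   ≤⟨ sum-mono-≤ {n} bound ⟩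
    sum {n} (λ _ → r M A)                     ≡⟨ sum-const n (r M A) ⟩
    n * r M A                                 ∎
    where
    open ≤-Reasoning
    c : State
    -- Since `m` is `-1` modulo `n`, this is `-x - 1` for the position `x` of `e`.
    c e = toℕ (σ ⟨$⟩ˡ e) * m + m
    pos : ∀ x → (c (σ ⟨$⟩ʳ x) + toℕ x) % n ≡ m
    pos x = begin-equality
      (c (σ ⟨$⟩ʳ x) + toℕ x) % n     ≡⟨ cong (λ y → (toℕ y * m + m + toℕ x) % n) (inverseˡ σ) ⟩
      (toℕ x * m + m + toℕ x) % n    ≡⟨ cong (λ s → (s + toℕ x) % n) (+-comm (toℕ x * m) m) ⟩
      (m + toℕ x * m + toℕ x) % n    ≡⟨ cong (_% n) (+-assoc m (toℕ x * m) (toℕ x)) ⟩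
      (m + (toℕ x * m + toℕ x)) % n  ≡⟨ cong (λ s → (m + s) % n) (trans (+-comm (toℕ x * m) (toℕ x)) (sym (*-suc (toℕ x) m))) ⟩
      (m + toℕ x * n) % n            ≡⟨ [m+kn]%n≡m%n m (toℕ x) n ⟩
      m % n                          ≡⟨ m<n⇒m%n≡m (n<1+n m) ⟩
      m                              ∎
    -- A subset of a base is independent. Independence enters through coloops: deleting any element
    -- of the base `W` lowers its rank.
    bound : ∀ i → ∣ I c (k + toℕ i) ∩ A ∣ ≤ r M A
    bound i = begin
      ∣ P ∣              ≤⟨ m≤n+m _ (r M ∅) ⟩
      r M ∅ + ∣ P ∣      ≤⟨ coloop-r-∪ {U = W} P (coloop ∘ P⊆W) (λ x∈ → contradiction x∈ ∉⊥) P⊆W (λ _ → ∉⊥) ⟩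
      r M (∅ ∪ P)        ≤⟨ r-mono M (∪-least (λ x∈ → contradiction x∈ ∉⊥) (p∩q⊆q (I c (k + toℕ i)) A)) ⟩
      r M A              ∎
      where
      W P : Subset n
      W = window σ i k
      P = I c (k + toℕ i) ∩ A
      P⊆W : P ⊆ W
      P⊆W = I⊆window σ c pos i ∘ p∩q⊆p (I c (k + toℕ i)) A
      coloop : ∀ {g} → g ∈ W → Coloop W g
      coloop {g} g∈W ⊢g = <-irrefl refl (begin-strict
        ∣ W ∣                    ≡⟨ proj₁ (base i) ⟨
        r M W                    ≤⟨ r-mono M ⊆-∪⁅⁆ ⟩
        r M ((W - g) ∪ ⁅ g ⁆)    ≤⟨ ⊢g ⟩
        r M (W - g)              ≤⟨ r-bound M (W - g) ⟩
        ∣ W - g ∣                <⟨ x∈p⇒∣p-x∣<∣p∣ g∈W ⟩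
        ∣ W ∣                    ∎)

  -- From the density bound to a base ordering.

  -- Only c modulo n matters, so the states can be searched exhaustively.
  good-state : 0 < k → UniformDensity M → Σ[ c ∈ State ] Good c
  good-state 0<k density with Fin.any? {n ^ n} (λ x → Fin.all? λ i → k ≤? r M (I (toℕ ∘ finToFun {n} {n} x) (toℕ i)))
  ... | yes (x , good) = toℕ ∘ finToFun x , good
  ... | no  none       = ⊥-elim (¬∀¬Good 0<k density λ c good → none (encode c , λ i →
          subst (λ J → k ≤ r M J) (I-cong c _ (toℕ i) (toℕ i) (same c (toℕ i))) (good i)))
    where
    encode : State → Fin (n ^ n)
    encode c = funToFin {n} {n} λ e → c e mod n
    same : ∀ c i e → (c e + i) % n ≡ (toℕ (finToFun {n} {n} (encode c) e) + i) % n
    same c i e = begin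
      (c e + i) % n                                     ≡⟨ cong (_% n) (+-comm (c e) i) ⟩
      (i + c e) % n                                     ≡⟨ %-congʳ-+ i (c e) (c e % n) (sym (m%n%n≡m%n (c e) n)) ⟩
      (i + c e % n) % n                                 ≡⟨ cong (λ t → (i + t) % n) (Fin.toℕ-fromℕ< (m%n<n (c e) n)) ⟨
      (i + toℕ (c e mod n)) % n                         ≡⟨ cong (λ t → (i + toℕ t) % n) (Fin.finToFun-funToFin (λ e → c e mod n) e) ⟨
      (i + toℕ (finToFun {n} {n} (encode c) e)) % n     ≡⟨ cong (_% n) (+-comm i _) ⟩
      (toℕ (finToFun {n} {n} (encode c) e) + i) % n     ∎
      where open ≡-Reasoning

  module _ (c : State) (good : Good c) where

    good-ℕ : ∀ i → k ≤ r M (I c i)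
    good-ℕ i = subst (λ J → k ≤ r M J) (sym (I-mod c i)) (good (i mod n))

    -- Every size is at least the rank, hence at least `k`, while the sizes over one period sum to
    -- `n * k`.
    ∣I∣≡k : ∀ i → ∣ I c i ∣ ≡ k
    ∣I∣≡k i = ≤-antisym
      (subst (λ J → ∣ J ∣ ≤ k) (sym (I-mod c i))
        (sum-≤⇒≥ {n} (λ i → ≤-trans (good i) (r-bound M (I c (toℕ i)))) Σ≤ (i mod n)))
      (≤-trans (good-ℕ i) (r-bound M (I c i)))
      where
      open ≤-Reasoning
      Σ≤ : sum {n} (λ i → ∣ I c (toℕ i) ∣) ≤ sum {n} (λ _ → k)
      Σ≤ = begin
        sum {n} (λ i → ∣ I c (toℕ i) ∣)       ≡⟨ sum-cong-≗ {n} (λ i → cong ∣_∣ (∩-identityʳ (I c (toℕ i)))) ⟨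
        sum {n} (λ i → ∣ I c (toℕ i) ∩ ⊤ ∣)   ≡⟨ sum-∣I∩∣ c 0 ⊤ ⟩
        k * ∣ ⊤ {n} ∣                         ≡⟨ cong (k *_) (∣⊤∣≡n n) ⟩
        k * n                                 ≡⟨ *-comm k n ⟩
        n * k                                 ≡⟨ sum-const n k ⟨
        sum {n} (λ _ → k)                     ∎

    at? : ∀ j i e → Dec ((c e + i) % n ≡ j)
    at? j i e = (c e + i) % n ≟ j

    -- Offset `k - 1` marks the last active time, and offset `m` means that the arc starts at the
    -- next time. So `#at m i` counts the arcs starting at `i + 1`.
    #at : ℕ → ℕ → ℕ
    #at j i = sum {n} λ e → 𝟙 (does (at? j i e))

    #at-shift : ∀ j d i → j + d < n → #at j i ≡ #at (j + d) (i + d)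
    #at-shift j d i j+d<n = sum-cong-≗ {n} λ e → cong 𝟙 (does-⇔ (mk⇔ (to e) (from e)) (at? j i e) (at? (j + d) (i + d) e))
      where
      open ≡-Reasoning
      rearrange : ∀ e → (c e + (i + d)) % n ≡ (d + (c e + i)) % n
      rearrange e = cong (_% n) (trans (sym (+-assoc (c e) i d)) (+-comm (c e + i) d))
      to : ∀ e → (c e + i) % n ≡ j → (c e + (i + d)) % n ≡ j + d
      to e eq = begin
        (c e + (i + d)) % n  ≡⟨ rearrange e ⟩
        (d + (c e + i)) % n  ≡⟨ %-congʳ-+ d (c e + i) j (trans eq (sym (m<n⇒m%n≡m (≤-<-trans (m≤m+n j d) j+d<n)))) ⟩
        (d + j) % n          ≡⟨ cong (_% n) (+-comm d j) ⟩
        (j + d) % n          ≡⟨ m<n⇒m%n≡m j+d<n ⟩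
        j + d                ∎
      from : ∀ e → (c e + (i + d)) % n ≡ j + d → (c e + i) % n ≡ j
      from e eq = trans
        (%-cancelˡ d (c e + i) j (begin
          (d + (c e + i)) % n  ≡⟨ rearrange e ⟨
          (c e + (i + d)) % n  ≡⟨ eq ⟩
          j + d                ≡⟨ m<n⇒m%n≡m j+d<n ⟨
          (j + d) % n          ≡⟨ cong (_% n) (+-comm j d) ⟩
          (d + j) % n          ∎))
        (m<n⇒m%n≡m (≤-<-trans (m≤m+n j d) j+d<n))

    module _ (k′ : ℕ) (k≡ : k ≡ suc k′) where

      k′≤m : k′ ≤ m
      k′≤m = s≤s⁻¹ (subst (_≤ n) k≡ (rank≤n M))

      -- All I c i have the same size, so at each time as many elements leave as enter.
      #at-balance : ∀ i → #at k′ i ≡ #at m i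
      #at-balance i = +-cancelˡ-≡ k _ _ (begin
        k + #at k′ i
          ≡⟨ cong (_+ #at k′ i) (trans (sym (∣I∣≡k (suc i))) (trans (∣I∣ c (suc i))
               (sum-cong-≗ {n} λ e → cong (λ t → 𝟙 (does (t % n <? k))) (+-suc (c e) i)))) ⟩
        sum {n} (λ e → 𝟙 (does (suc (c e + i) % n <? k))) + #at k′ i
          ≡⟨ ∑-distrib-+ {n} (λ e → 𝟙 (does (suc (c e + i) % n <? k))) (λ e → 𝟙 (does (at? k′ i e))) ⟨
        sum {n} (λ e → 𝟙 (does (suc (c e + i) % n <? k)) + 𝟙 (does (at? k′ i e)))
          ≡⟨ sum-cong-≗ {n} (λ e → subst (λ l → 𝟙 (does (suc (c e + i) % n <? l)) + 𝟙 (does (at? k′ i e)) ≡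
                                        𝟙 (does ((c e + i) % n <? l)) + 𝟙 (does (at? m i e)))
                               (sym k≡) (arc-step k′≤m (c e + i))) ⟩
        sum {n} (λ e → 𝟙 (does (inArc? c i e)) + 𝟙 (does (at? m i e)))
          ≡⟨ ∑-distrib-+ {n} (λ e → 𝟙 (does (inArc? c i e))) (λ e → 𝟙 (does (at? m i e))) ⟩
        sum {n} (λ e → 𝟙 (does (inArc? c i e))) + #at m i
          ≡⟨ cong (_+ #at m i) (trans (sym (∣I∣ c i)) (∣I∣≡k i)) ⟩
        k + #at m i ∎)
        where open ≡-Reasoning

      #at-period-n : ∀ i → #at m (i + n) ≡ #at m i
      #at-period-n i = sum-cong-≗ {n} λ e → cong (λ t → 𝟙 (does (t ≟ m)))
        (trans (cong (_% n) (sym (+-assoc (c e) i n))) ([m+n]%n≡m%n (c e + i) n))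

      -- Elements at offset `k′` reach offset `m` after `m ∸ k′` steps, and by balance they are as
      -- many as those at offset `m` now.
      #at-period-d : ∀ i → #at m (i + (m ∸ k′)) ≡ #at m i
      #at-period-d i = begin
        #at m (i + (m ∸ k′))              ≡⟨ cong (λ j → #at j (i + (m ∸ k′))) (m+[n∸m]≡n k′≤m) ⟨
        #at (k′ + (m ∸ k′)) (i + (m ∸ k′)) ≡⟨ #at-shift k′ (m ∸ k′) i (s≤s (≤-reflexive (m+[n∸m]≡n k′≤m))) ⟨
        #at k′ i                          ≡⟨ #at-balance i ⟩
        #at m i                           ∎
        where open ≡-Reasoning

      -- The periods `n` and `m ∸ k′` differ by `k`.
      #at-period-k : ∀ i → #at m (i + k) ≡ #at m i
      #at-period-k i = begin
        #at m (i + k)                ≡⟨ #at-period-d (i + k) ⟨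
        #at m (i + k + (m ∸ k′))     ≡⟨ cong (#at m) (trans (+-assoc i k _) (cong (i +_)
                                       (trans (cong (_+ (m ∸ k′)) k≡) (cong suc (m+[n∸m]≡n k′≤m))))) ⟩
        #at m (i + n)                ≡⟨ #at-period-n i ⟩
        #at m i                      ∎
        where open ≡-Reasoning

      module _ (cop : Coprime n k) where

        -- The count `#at m` is constant by coprimality, and positive at one time.
        occupied : ∀ i → ∃ λ e → (c e + i) % n ≡ m
        occupied i with nonempty? ⟪ at? m i ⟫
        ... | yes (e , e∈) = e , ∈⟪⟫⁻ (at? m i) e∈
        ... | no  empty    = contradiction (begin-strict
          0                   <⟨ s≤s z≤n ⟩
          1                   ≡⟨ ∣⁅x⁆∣≡1 {n} zero ⟨
          ∣ ⁅ zero {m} ⁆ ∣    ≤⟨ p⊆q⇒∣p∣≤∣q∣ (⁅⁆⊆ (∈⟪⟫⁺ (at? m i₀) pos₀)) ⟩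
          ∣ ⟪ at? m i₀ ⟫ ∣    ≡⟨ ∣⟪⟫∣ (at? m i₀) ⟩
          #at m i₀              ≡⟨ constant i₀ ⟩
          #at m 0               ≡⟨ constant i ⟨
          #at m i               ≡⟨ ∣⟪⟫∣ (at? m i) ⟨
          ∣ ⟪ at? m i ⟫ ∣     ≡⟨ cong ∣_∣ (Empty-unique empty) ⟩
          ∣ ∅ {n} ∣           ≡⟨ ∣⊥∣≡0 n ⟩
          0                   ∎) (<-irrefl refl)
          where
          open ≤-Reasoning
          constant : ∀ i → #at m i ≡ #at m 0
          constant = coprime-periods⇒constant (#at m) cop #at-period-n #at-period-k
          c₀ = c zero
          -- Congruent to `-1 - c₀`, so the element `zero` has offset `m` at this time.
          i₀ = c₀ * m + m
          pos₀ : (c₀ + i₀) % n ≡ m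
          pos₀ = trans (cong (_% n) (trans (sym (+-assoc c₀ (c₀ * m) m)) (trans (+-comm _ m) (cong (m +_) (sym (*-suc c₀ m))))))
            (trans ([m+kn]%n≡m%n m c₀ n) (m<n⇒m%n≡m (n<1+n m)))

        occupant : Fin n → Fin n
        occupant x = proj₁ (occupied (toℕ x))

        -- The offset of a fixed element determines the time modulo `n`.
        occupant-injective : ∀ {x y} → occupant x ≡ occupant y → x ≡ y
        occupant-injective {x} {y} eq = Fin.toℕ-injective (begin
          toℕ x      ≡⟨ m<n⇒m%n≡m (Fin.toℕ<n x) ⟨
          toℕ x % n  ≡⟨ %-cancelˡ (c (occupant x)) (toℕ x) (toℕ y) (trans (proj₂ (occupied (toℕ x)))
                          (sym (subst (λ e → (c e + toℕ y) % n ≡ m) (sym eq) (proj₂ (occupied (toℕ y)))))) ⟩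
          toℕ y % n  ≡⟨ m<n⇒m%n≡m (Fin.toℕ<n y) ⟩
          toℕ y      ∎)
          where open ≡-Reasoning

        -- Each window has at most `k` elements and contains an active set of rank at least `k`,
        -- which forces both base conditions.
        ordering : HasCyclicBaseOrdering M
        ordering = σ , λ i → ≤-antisym (r-bound M _) (≤-trans (∣window∣≤ σ i k) (k≤rW i))
                           , ≤-antisym (∣window∣≤ σ i k) (≤-trans (k≤rW i) (r-bound M _))
          where
          preimage : ∀ e → ∃ λ x → occupant x ≡ e
          preimage = injective⇒surjective occupant occupant-injective
          σ : Permutation′ n
          σ = permutation occupant (proj₁ ∘ preimage) (λ e → proj₂ (preimage e))
                (λ x → occupant-injective (proj₂ (preimage (occupant x))))
          k≤rW : ∀ i → k ≤ r M (window σ i k)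
          k≤rW i = ≤-trans (good-ℕ (k + toℕ i))
            (r-mono M (I⊆window σ c (λ x → proj₂ (occupied (toℕ x))) i))

  0<rank : Loopless M → 0 < k
  0<rank loopless = ≤-trans (≤-reflexive (sym (loopless zero))) (r-mono M ⊆⊤)

  density⇒ordering : Loopless M → Coprime n k → UniformDensity M → HasCyclicBaseOrdering M
  density⇒ordering loopless cop density =
    let c , good = good-state (0<rank loopless) density
    in  ordering c good (pred k) (sym (suc-pred k {{>-nonZero (0<rank loopless)}})) cop

theorem1p4 : ∀ {n : ℕ} (M : Matroid n) → Loopless M → Coprime n (rankM M) →
    (HasCyclicBaseOrdering M ⇔ UniformDensity M)
-- On the empty ground set there is no nonempty `A` and no starting point of a window.
theorem1p4 {zero}  M loopless cop = mk⇔ (λ { _ _ (() , _) }) (λ _ → permutation id id (λ _ → refl) (λ _ → refl) , λ ())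
theorem1p4 {suc m} M loopless cop = mk⇔ ordering⇒density (density⇒ordering loopless cop)
  where open CyclicOrdering M
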